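{- For every natural number $n \geq 0$, the empty clause $\vdash$ is derivable by resolution from the clause set $C(n)$.
   Context: Language: first-order terms are built from variables, a unary function symbol $s$ and a binary function symbol $max$; there are also a unary function symbol $f$ and constants (numerals) $\overline{0},\overline{1},\overline{2},\dots$. Atoms are of the form $u\leq v$ or $f(u)=\overline{i}$; both $\leq$ and $=$ are treated as ordinary (uninterpreted) predicate symbols, with no built-in equality or arithmetic axioms. A clause is a sequent $\Pi\vdash\Delta$ with $\Pi,\Delta$ finite multisets of atoms; its variables are implicitly universally quantified. The numeral $\overline{i}$ is also written $i$. For $n\geq 0$, $C(n)$ is the set of the following clauses ($\alpha,\beta,\gamma$ variables): (C1) $\vdash \alpha\leq\alpha$; (C2) $max(\alpha,\beta)\leq\gamma\vdash\alpha\leq\gamma$; (C3) $max(\alpha,\beta)\leq\gamma\vdash\beta\leq\gamma$; (C4$_i$) $f(\beta)=\overline{i},\ f(\alpha)=\overline{i},\ s(\beta)\leq\alpha\vdash$, for each $0\leq i\leq n$; (C5) $\vdash f(\alpha)=\overline{0},\dots,f(\alpha)=\overline{n}$. Resolution rule: from $\Pi\vdash P^{*},\Delta$ and $\Pi',P^{**}\vdash\Delta'$ and a substitution $\sigma$ with $P^{*}\sigma=P^{**}\sigma=P$, where $P$ does not occur in $\Pi'\sigma$ nor in $\Delta\sigma$, infer $\Pi\sigma,\Pi'\sigma\vdash\Delta\sigma,\Delta'\sigma$. A clause is derivable by resolution from $C(n)$ if it is obtained from clauses of $C(n)$ by finitely many applications of this rule, together with taking substitution instances (in particular renaming variables) and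 contracting duplicate atoms on either side of $\vdash$. -}

module Defs where

open import Level using (0ℓ)
open import Data.Nat using (ℕ; suc; _≤_)
open import Data.List using (List; []; _∷_; _++_; map; upTo)
open import Data.List.Membership.Propositional using (_∉_)
open import Data.List.Relation.Binary.Permutation.Propositional using (_↭_)
open import Relation.Binary.PropositionalEquality using (_≡_)
open import Relation.Unary using (Pred)

infix 6 _≼_ f⟨_⟩≐_
infix 4 _⊢_
infixl 8 _[_]ᵗ _[_]ᵃ _[_]ˡ _[_]ᶜ

data Term : Set where
  var : ℕ → Term
  s   : Term → Term
  max : Term → Term → Term

-- f occurs only as the head of the left-hand side of an equation and a numeral
-- only as its right-hand side, so `f⟨ u ⟩≐ i` is the whole atom f(u) = i, with
-- the numeral given by its index.
data Atom : Set where
  _≼_    : Term → Term → Atom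
  f⟨_⟩≐_ : Term → ℕ → Atom

-- The two sides are multisets: the order in the lists is made irrelevant by the
-- constructor `exchange` of `Derivable`.
record Clause : Set where
  constructor _⊢_
  field
    antecedent : List Atom
    succedent  : List Atom

Subst : Set
Subst = ℕ → Term

_[_]ᵗ : Term → Subst → Term
var x   [ σ ]ᵗ = σ x
s t     [ σ ]ᵗ = s (t [ σ ]ᵗ)
max t u [ σ ]ᵗ = max (t [ σ ]ᵗ) (u [ σ ]ᵗ)

_[_]ᵃ : Atom → Subst → Atom
(t ≼ u)     [ σ ]ᵃ = t [ σ ]ᵗ ≼ u [ σ ]ᵗ
(f⟨ t ⟩≐ i) [ σ ]ᵃ = f⟨ t [ σ ]ᵗ ⟩≐ i

_[_]ˡ : List Atom → Subst → List Atom
Γ [ σ ]ˡ = map (_[ σ ]ᵃ) Γ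

_[_]ᶜ : Clause → Subst → Clause
(Π ⊢ Δ) [ σ ]ᶜ = Π [ σ ]ˡ ⊢ Δ [ σ ]ˡ

-- Premises of `resolve` need not be variable-disjoint; standardising them apart
-- is a use of `instantiate`.
data Derivable (S : Pred Clause 0ℓ) : Pred Clause 0ℓ where
  initial     : ∀ {c} → S c → Derivable S c
  exchange    : ∀ {Π Π′ Δ Δ′} → Π ↭ Π′ → Δ ↭ Δ′ →
                Derivable S (Π ⊢ Δ) → Derivable S (Π′ ⊢ Δ′)
  instantiate : ∀ {c} (σ : Subst) → Derivable S c → Derivable S (c [ σ ]ᶜ)
  contractˡ   : ∀ {A Π Δ} → Derivable S (A ∷ A ∷ Π ⊢ Δ) → Derivable S (A ∷ Π ⊢ Δ)
  contractʳ   : ∀ {A Π Δ} → Derivable S (Π ⊢ A ∷ A ∷ Δ) → Derivable S (Π ⊢ A ∷ Δ)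
  resolve     : ∀ {Π Δ Π′ Δ′ P* P** P} (σ : Subst) →
                Derivable S (Π ⊢ P* ∷ Δ) →
                Derivable S (P** ∷ Π′ ⊢ Δ′) →
                P* [ σ ]ᵃ ≡ P → P** [ σ ]ᵃ ≡ P →
                P ∉ Π′ [ σ ]ˡ → P ∉ Δ [ σ ]ˡ →
                Derivable S (Π [ σ ]ˡ ++ Π′ [ σ ]ˡ ⊢ Δ [ σ ]ˡ ++ Δ′ [ σ ]ˡ)

α β γ : Term
α = var 0
β = var 1
γ = var 2

data C (n : ℕ) : Pred Clause 0ℓ where
  C1 : C n ([] ⊢ α ≼ α ∷ [])
  C2 : C n (max α β ≼ γ ∷ [] ⊢ α ≼ γ ∷ [])
  C3 : C n (max α β ≼ γ ∷ [] ⊢ β ≼ γ ∷ [])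
  C4 : ∀ i → i ≤ n → C n (f⟨ β ⟩≐ i ∷ f⟨ α ⟩≐ i ∷ s β ≼ α ∷ [] ⊢ [])
  C5 : C n ([] ⊢ map (f⟨ α ⟩≐_) (upTo (suc n)))

{-# OPTIONS --safe #-}
-- Put t₀ = α and tₖ₊₁ = max(s(tₖ), tₖ).  Starting from tₖ ≤ tₖ, the clauses C3 and
-- C2 give s(tⱼ) ≤ tₖ for all j < k, so by C4 no two of the terms t₀, …, tₙ₊₁ have
-- the same f-value.  By C5 these n + 2 terms take only n + 1 values.  The case
-- distinction over all their values is a tree of cuts, each of which is a
-- resolution step up to contraction and weakening.
module Submission where

open import Defs
open import Data.Empty using (⊥-elim)
open import Data.Fin using (Fin; toℕ; fromℕ<)
open import Data.Fin.Properties using (pigeonhole; toℕ<n; toℕ-fromℕ<)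
open import Data.List using (List; []; _∷_; _++_; filter; map; upTo)
open import Data.List.Membership.Propositional using (_∈_; _∉_)
open import Data.List.Membership.Propositional.Properties
  using (∈-∃++; ∈-filter⁻; ∈-map⁻; ∈-upTo⁻; ∈-++⁻)
import Data.List.Membership.DecPropositional as DecMembership
open import Data.List.Properties using (map-id; map-cong; ++-identityʳ)
open import Data.List.Relation.Binary.Permutation.Propositional
  using (_↭_; ↭-refl; ↭-sym; prep)
open import Data.List.Relation.Binary.Permutation.Propositional.Properties
  using (shift; ∈-resp-↭)
open import Data.List.Relation.Binary.Subset.Propositional using (_⊆_)
open import Data.List.Relation.Binary.Subset.Propositional.Properties
  using (xs⊆xs++ys; xs⊆ys++xs)
open import Data.List.Relation.Unary.Any using (here; there)
open import Data.Nat using (ℕ; zero; suc; _+_; _<_; _≤_; _≤′_; ≤′-refl; ≤′-step; s≤s⁻¹)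
import Data.Nat as ℕ
open import Data.Nat.Properties using (≤⇒≤′; m<1+n⇒m<n∨m≡n; n<1+n)
open import Data.Product using (∃; _×_; _,_; proj₁; proj₂; uncurry)
open import Data.Sum using (inj₁; inj₂; [_,_])
open import Function using (id; _∘_)
open import Level using (0ℓ)
open import Relation.Binary.Definitions using (DecidableEquality)
open import Relation.Binary.PropositionalEquality
  using (_≡_; refl; sym; trans; cong; cong₂; subst; subst₂)
open import Relation.Nullary using (yes; no; ¬?)
open import Relation.Nullary.Decidable using (map′; _×-dec_)
open import Relation.Unary using (Pred)

_≟ᵗ_ : DecidableEquality Term
var x   ≟ᵗ var y   = map′ (cong var) (λ { refl → refl }) (x ℕ.≟ y)
var _   ≟ᵗ s _     = no λ ()
var _   ≟ᵗ max _ _ = no λ ()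
s _     ≟ᵗ var _   = no λ ()
s t     ≟ᵗ s u     = map′ (cong s) (λ { refl → refl }) (t ≟ᵗ u)
s _     ≟ᵗ max _ _ = no λ ()
max _ _ ≟ᵗ var _   = no λ ()
max _ _ ≟ᵗ s _     = no λ ()
max t u ≟ᵗ max v w =
  map′ (uncurry (cong₂ max)) (λ { refl → refl , refl }) (t ≟ᵗ v ×-dec u ≟ᵗ w)

_≟ᵃ_ : DecidableEquality Atom
(t ≼ u)    ≟ᵃ (v ≼ w)    =
  map′ (uncurry (cong₂ _≼_)) (λ { refl → refl , refl }) (t ≟ᵗ v ×-dec u ≟ᵗ w)
(_ ≼ _)    ≟ᵃ (f⟨ _ ⟩≐ _) = no λ ()
(f⟨ _ ⟩≐ _) ≟ᵃ (_ ≼ _)    = no λ ()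
(f⟨ t ⟩≐ i) ≟ᵃ (f⟨ u ⟩≐ j) =
  map′ (uncurry (cong₂ f⟨_⟩≐_)) (λ { refl → refl , refl }) (t ≟ᵗ u ×-dec i ℕ.≟ j)

open DecMembership _≟ᵃ_ using (_∈?_)

var-idᵗ : ∀ t → t [ var ]ᵗ ≡ t
var-idᵗ (var x)   = refl
var-idᵗ (s t)     = cong s (var-idᵗ t)
var-idᵗ (max t u) = cong₂ max (var-idᵗ t) (var-idᵗ u)

var-idᵃ : ∀ A → A [ var ]ᵃ ≡ A
var-idᵃ (t ≼ u)     = cong₂ _≼_ (var-idᵗ t) (var-idᵗ u)
var-idᵃ (f⟨ t ⟩≐ i) = cong (f⟨_⟩≐ i) (var-idᵗ t)

var-idˡ : ∀ Γ → Γ [ var ]ˡ ≡ Γ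
var-idˡ Γ = trans (map-cong var-idᵃ Γ) (map-id Γ)

infixl 7 _∖_

-- Every copy goes, not just one, since `resolve` demands that the cut atom be absent from the rest
-- of its side in each premise.
_∖_ : List Atom → Atom → List Atom
Γ ∖ A = filter (¬? ∘ (A ≟ᵃ_)) Γ

∉-∖ : ∀ {A} Γ → A ∉ Γ ∖ A
∉-∖ Γ A∈ = proj₂ (∈-filter⁻ _ {xs = Γ} A∈) refl

⊆∷-∉⇒⊆ : ∀ {A : Atom} {Γ Θ} → A ∉ Γ → Γ ⊆ A ∷ Θ → Γ ⊆ Θ
⊆∷-∉⇒⊆ A∉Γ Γ⊆ x∈Γ with Γ⊆ x∈Γ
... | here refl = ⊥-elim (A∉Γ x∈Γ)
... | there x∈Θ = x∈Θ

∖-⊆ : ∀ {A Θ} Γ → Γ ⊆ A ∷ Θ → Γ ∖ A ⊆ Θ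
∖-⊆ Γ Γ⊆ = ⊆∷-∉⇒⊆ (∉-∖ Γ) (Γ⊆ ∘ proj₁ ∘ ∈-filter⁻ _ {xs = Γ})

-- Stated for an arbitrary predicate so that it applies to both sides of a clause.
module Contraction
  (Q : Pred (List Atom) 0ℓ)
  (permute  : ∀ {Γ Θ} → Γ ↭ Θ → Q Γ → Q Θ)
  (contract : ∀ {A Γ} → Q (A ∷ A ∷ Γ) → Q (A ∷ Γ))
  where

  -- Atoms other than `A` are moved behind `Γ` into `Θ`, so each further copy of `A` comes to stand
  -- next to the head and can be contracted into it.
  absorb : ∀ {A} Γ {Θ} → Q (A ∷ Γ ++ Θ) → Q (A ∷ Γ ∖ A ++ Θ)
  absorb {A} []      q = q
  absorb {A} (B ∷ Γ) {Θ} q with A ≟ᵃ B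
  ... | yes refl = absorb Γ (contract q)
  ... | no  _    = permute (prep A (shift B (Γ ∖ A) Θ))
                     (absorb Γ (permute (prep A (↭-sym (shift B Γ Θ))) q))

  isolate : ∀ {A Γ Θ} → A ∈ Γ → Γ ⊆ A ∷ Θ → Q Γ →
            ∃ λ Γ′ → A ∉ Γ′ × Γ′ ⊆ Θ × Q (A ∷ Γ′)
  isolate {A} A∈Γ Γ⊆ q with ys , zs , refl ← ∈-∃++ A∈Γ =
    (ys ++ zs) ∖ A , ∉-∖ (ys ++ zs) ,
    ∖-⊆ (ys ++ zs) (Γ⊆ ∘ ∈-resp-↭ (↭-sym (shift A ys zs)) ∘ there) ,
    subst (Q ∘ (A ∷_)) (++-identityʳ _)
      (absorb (ys ++ zs)
        (subst (Q ∘ (A ∷_)) (sym (++-identityʳ _)) (permute (shift A ys zs) q)))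

module _ {S : Pred Clause 0ℓ} where

  isolateˡ : ∀ {A Π Θ Δ} → A ∈ Π → Π ⊆ A ∷ Θ → Derivable S (Π ⊢ Δ) →
             ∃ λ Π′ → A ∉ Π′ × Π′ ⊆ Θ × Derivable S (A ∷ Π′ ⊢ Δ)
  isolateˡ {Δ = Δ} = Contraction.isolate (λ Π → Derivable S (Π ⊢ Δ))
    (λ p → exchange p ↭-refl) contractˡ

  isolateʳ : ∀ {A Π Δ Θ} → A ∈ Δ → Δ ⊆ A ∷ Θ → Derivable S (Π ⊢ Δ) →
             ∃ λ Δ′ → A ∉ Δ′ × Δ′ ⊆ Θ × Derivable S (Π ⊢ A ∷ Δ′)
  isolateʳ {Π = Π} = Contraction.isolate (λ Δ → Derivable S (Π ⊢ Δ))
    (exchange ↭-refl) contractʳ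

  -- Premises may share variables, so with the identity substitution the variables act as constants
  -- and resolution becomes a propositional cut.
  resolveGround : ∀ {A Π Δ Π′ Δ′} →
    Derivable S (Π ⊢ A ∷ Δ) → Derivable S (A ∷ Π′ ⊢ Δ′) → A ∉ Π′ → A ∉ Δ →
    Derivable S (Π ++ Π′ ⊢ Δ ++ Δ′)
  resolveGround {A} {Π} {Δ} {Π′} {Δ′} d e A∉Π′ A∉Δ =
    subst₂ (λ Γ Θ → Derivable S (Γ ⊢ Θ))
      (cong₂ _++_ (var-idˡ Π) (var-idˡ Π′)) (cong₂ _++_ (var-idˡ Δ) (var-idˡ Δ′))
      (resolve var d e (var-idᵃ A) (var-idᵃ A)
        (subst (A ∉_) (sym (var-idˡ Π′)) A∉Π′) (subst (A ∉_) (sym (var-idˡ Δ)) A∉Δ))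

-- Weakening is not a rule of the calculus; entailment up to subsumption admits it.
infix 3 _∣_⇒_

_∣_⇒_ : Pred Clause 0ℓ → List Atom → List Atom → Set
S ∣ Π ⇒ Δ = ∃ λ Π₀ → ∃ λ Δ₀ → Derivable S (Π₀ ⊢ Δ₀) × Π₀ ⊆ Π × Δ₀ ⊆ Δ

⊆[]⇒≡[] : ∀ {Γ : List Atom} → Γ ⊆ [] → Γ ≡ []
⊆[]⇒≡[] {[]}    _  = refl
⊆[]⇒≡[] {A ∷ Γ} Γ⊆ with () ← Γ⊆ (here refl)

module _ {S : Pred Clause 0ℓ} where

  -- Nothing but the empty clause subsumes the empty clause, so the weakening hidden in the
  -- entailment costs nothing at the end.
  ⇒-empty : S ∣ [] ⇒ [] → Derivable S ([] ⊢ [])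
  ⇒-empty (_ , _ , d , Π₀⊆ , Δ₀⊆)
    with refl ← ⊆[]⇒≡[] Π₀⊆ | refl ← ⊆[]⇒≡[] Δ₀⊆ = d

  weaken : ∀ {Π Π′ Δ Δ′} → Π ⊆ Π′ → Δ ⊆ Δ′ → S ∣ Π ⇒ Δ → S ∣ Π′ ⇒ Δ′
  weaken Π⊆ Δ⊆ (_ , _ , d , Π₀⊆ , Δ₀⊆) = _ , _ , d , Π⊆ ∘ Π₀⊆ , Δ⊆ ∘ Δ₀⊆

  instanceOf : ∀ {Π Δ} (σ : Subst) → S (Π ⊢ Δ) → S ∣ Π [ σ ]ˡ ⇒ Δ [ σ ]ˡ
  instanceOf σ c = _ , _ , instantiate σ (initial c) , id , id

  cut : ∀ {A Π Δ} → S ∣ Π ⇒ A ∷ Δ → S ∣ A ∷ Π ⇒ Δ → S ∣ Π ⇒ Δ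
  cut {A} (Π₁ , Δ₁ , d , Π₁⊆ , Δ₁⊆) (Π₂ , Δ₂ , e , Π₂⊆ , Δ₂⊆)
    with A ∈? Δ₁ | A ∈? Π₂
  -- If a subsuming clause lacks the cut atom, that clause alone already subsumes the conclusion.
  ... | no A∉Δ₁ | _       = Π₁ , Δ₁ , d , Π₁⊆ , ⊆∷-∉⇒⊆ A∉Δ₁ Δ₁⊆
  ... | yes _   | no A∉Π₂ = Π₂ , Δ₂ , e , ⊆∷-∉⇒⊆ A∉Π₂ Π₂⊆ , Δ₂⊆
  ... | yes A∈Δ₁ | yes A∈Π₂
    with Δ₁′ , A∉Δ₁′ , Δ₁′⊆ , d′ ← isolateʳ A∈Δ₁ Δ₁⊆ d
       | Π₂′ , A∉Π₂′ , Π₂′⊆ , e′ ← isolateˡ A∈Π₂ Π₂⊆ e =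
    Π₁ ++ Π₂′ , Δ₁′ ++ Δ₂ , resolveGround d′ e′ A∉Π₂′ A∉Δ₁′ ,
    [ Π₁⊆ , Π₂′⊆ ] ∘ ∈-++⁻ Π₁ , [ Δ₁′⊆ , Δ₂⊆ ] ∘ ∈-++⁻ Δ₁′

  -- Case distinction over a disjunction: each atom of `Γ` is cut against its own branch.
  cutAll : ∀ {Π Δ} Γ → S ∣ Π ⇒ Γ ++ Δ → (∀ {A} → A ∈ Γ → S ∣ A ∷ Π ⇒ Δ) → S ∣ Π ⇒ Δ
  cutAll []      d _ = d
  cutAll (A ∷ Γ) d e =
    cutAll Γ (cut d (weaken id (xs⊆ys++xs _ Γ) (e (here refl)))) (e ∘ there)

  detach : ∀ {A B} → S ∣ [] ⇒ A ∷ [] → S ∣ A ∷ [] ⇒ B ∷ [] → S ∣ [] ⇒ B ∷ []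
  detach d = cut (weaken id (xs⊆xs++ys _ _) d)

t : ℕ → Term
t zero    = α
t (suc k) = max (s (t k)) (t k)

⟨_,_,_⟩ : Term → Term → Term → Subst
⟨ a , b , c ⟩ 0 = a
⟨ a , b , c ⟩ 1 = b
⟨ a , b , c ⟩ _ = c

module _ {n : ℕ} where

  -- `C3` keeps the right argument of `max`, which in `t (suc k)` is `t k`; `≤′` counts these steps
  -- down from the larger index.
  t≼-descends : ∀ {j k c} → j ≤′ k → C n ∣ [] ⇒ t k ≼ c ∷ [] → C n ∣ [] ⇒ t j ≼ c ∷ []
  t≼-descends         ≤′-refl           d = d
  t≼-descends {c = c} (≤′-step {k} j≤k) d =
    t≼-descends j≤k (detach d (instanceOf ⟨ s (t k) , t k , c ⟩ C3))

  st≼t : ∀ {j k} → j < k → C n ∣ [] ⇒ s (t j) ≼ t k ∷ []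
  st≼t {j} {k} j<k =
    -- As `j < k` means `suc j ≤ k`, the descent stops at `t (suc j)`, whose left argument `s (t j)`
    -- is then extracted by `C2`.
    detach (t≼-descends (≤⇒≤′ j<k) (instanceOf (λ _ → t k) C1))
           (instanceOf ⟨ s (t j) , t j , t k ⟩ C2)

  clash : ∀ {j k i Π} → j < k → i ≤ n → f⟨ t j ⟩≐ i ∈ Π → f⟨ t k ⟩≐ i ∈ Π → C n ∣ Π ⇒ []
  clash {j} {k} j<k i≤n tⱼ∈Π tₖ∈Π =
    cut (weaken (λ ()) id (st≼t j<k))
        (weaken (λ { (here refl)                 → there tⱼ∈Π
                   ; (there (here refl))         → there tₖ∈Π
                   ; (there (there (here refl))) → here refl })
                -- The larger index goes to `α`, the right side of the inequality in `C4`; the third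
                -- entry is a filler, as `γ` does not occur there.
                id (instanceOf ⟨ t k , t j , α ⟩ (C4 _ i≤n)))

  -- `Π` is a branch of the case tree at depth `k`. The values are taken in `Fin (suc n)` to suit
  -- `pigeonhole`.
  Valued : ℕ → List Atom → Set
  Valued k Π = ∀ {j} → j < k → ∃ λ (i : Fin (suc n)) → f⟨ t j ⟩≐ toℕ i ∈ Π

  extend : ∀ {k i Π} → i < suc n → Valued k Π → Valued (suc k) (f⟨ t k ⟩≐ i ∷ Π)
  extend {k} i<1+n v j<1+k with m<1+n⇒m<n∨m≡n j<1+k
  ... | inj₁ j<k  = proj₁ (v j<k) , there (proj₂ (v j<k))
  ... | inj₂ refl =
    fromℕ< i<1+n , here (cong (f⟨ t k ⟩≐_) (toℕ-fromℕ< i<1+n))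

  refute-pigeonhole : ∀ {Π} → Valued (2 + n) Π → C n ∣ Π ⇒ []
  refute-pigeonhole {Π} v =
    let value = λ (j : Fin (2 + n)) → v (toℕ<n j)
        j , k , j<k , vⱼ≡vₖ = pigeonhole (n<1+n (suc n)) (proj₁ ∘ value)
    in clash j<k (s≤s⁻¹ (toℕ<n (proj₁ (value k))))
         (subst (λ i → f⟨ t (toℕ j) ⟩≐ toℕ i ∈ Π) vⱼ≡vₖ (proj₂ (value j)))
         (proj₂ (value k))

  -- One level of the tree: `C5` at `t k` lists the possible values, and each branch adds one of
  -- them to `Π`.
  split-value : ∀ k {Π} → Valued k Π →
    (∀ {Π′} → Valued (suc k) Π′ → C n ∣ Π′ ⇒ []) → C n ∣ Π ⇒ []
  split-value k {Π} v refute =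
    cutAll _ (weaken (λ ()) (xs⊆xs++ys _ []) (instanceOf (λ _ → t k) C5)) branch
    where
    branch : ∀ {A} → A ∈ map (f⟨ α ⟩≐_) (upTo (suc n)) [ (λ _ → t k) ]ˡ → C n ∣ A ∷ Π ⇒ []
    branch A∈
      with _ , B∈ , refl ← ∈-map⁻ _ A∈
      with _ , i∈ , refl ← ∈-map⁻ _ B∈ = refute (extend (∈-upTo⁻ i∈) v)

  -- Refutability moves from the leaves at depth `k` up to the root, where no term has a value yet
  -- and the empty `Π` qualifies.
  refute-valued : ∀ k → (∀ {Π} → Valued k Π → C n ∣ Π ⇒ []) → C n ∣ [] ⇒ []
  refute-valued zero    refute = refute (λ ())
  refute-valued (suc k) refute = refute-valued k (λ v → split-value k v refute)

theorem2 : (n : ℕ) → Derivable (C n) ([] ⊢ [])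
theorem2 n = ⇒-empty (refute-valued (2 + n) refute-pigeonhole)
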